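{- Let $n\ge2$. For every $\Gamma\cup\{\varphi\}\subseteq{\bf F}(\Sigma,\mathcal{V})$: $\Gamma\vdash_{C_n}\varphi$ iff $\Gamma\vDash^{\mathsf{RN}}_{\mathcal{RM}_{C_n}}\varphi$.
   Context: $\Sigma$ has unary $\neg$ and binary $\wedge,\vee,\to$; ${\bf F}(\Sigma,\mathcal{V})$ its formulas over a denumerable set $\mathcal{V}$. $\alpha^0=\alpha$, $\alpha^{k+1}=\neg(\alpha^k\wedge\neg\alpha^k)$; $\alpha^{(1)}=\alpha^1$, $\alpha^{(k+1)}=\alpha^{(k)}\wedge\alpha^{k+1}$. $C_n$ is the Hilbert calculus with Modus Ponens and axiom schemata: $\alpha\to(\beta\to\alpha)$; $(\alpha\to(\beta\to\gamma))\to((\alpha\to\beta)\to(\alpha\to\gamma))$; $\alpha\to(\beta\to(\alpha\wedge\beta))$; $(\alpha\wedge\beta)\to\alpha$; $(\alpha\wedge\beta)\to\beta$; $\alpha\to(\alpha\vee\beta)$; $\beta\to(\alpha\vee\beta)$; $(\alpha\to\gamma)\to((\beta\to\gamma)\to((\alpha\vee\beta)\to\gamma))$; $\alpha\vee\neg\alpha$; $\neg\neg\alpha\to\alpha$; $\alpha^{(n)}\to(\alpha\to(\neg\alpha\to\beta))$; $(\alpha^{(n)}\wedge\beta^{(n)})\to((\alpha\wedge\beta)^{(n)}\wedge(\alpha\vee\beta)^{(n)}\wedge(\alpha\to\beta)^{(n)})$. $B_n=\{z\in\{0,1\}^{n+1}:(z_1\wedge\dots\wedge z_k)\vee z_{k+1}=1\text{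 for all }1\le k\le n\}$, with elements $T_n=(1,0,1,\dots,1)$, $t^n_i$ ($0\le i\le n-2$) having $z_1=z_2=1$ and a single $0$ at coordinate $i+3$, $t^n_{n-1}=(1,\dots,1)$, $F_n=(0,1,\dots,1)$. $D_n=\{z:z_1=1\}$, $Boo_n=\{T_n,F_n\}$, $I_n=B_n\setminus Boo_n$. $\mathcal{A}_{C_n}$ on $B_n$: $\tilde\neg z=\{w\in B_n:w_1=z_2,\ w_2\le z_1\}$; for $\#\in\{\wedge,\vee,\to\}$, $z\tilde\#w=\{u\in Boo_n:u_1=z_1\#w_1\}$ if $z,w\in Boo_n$, else $\{u\in B_n:u_1=z_1\#w_1\}$. A valuation is $\nu$ with $\nu(\neg\alpha)\in\tilde\neg\nu(\alpha)$, $\nu(\alpha\#\beta)\in\nu(\alpha)\tilde\#\nu(\beta)$. $\mathcal{F}_{C_n}$: valuations with $\nu(\alpha)=t^n_0\Rightarrow\nu(\alpha\wedge\neg\alpha)=T_n$, and for $1\le k\le n-1$, $\nu(\alpha)=t^n_k\Rightarrow(\nu(\alpha\wedge\neg\alpha)\in I_n$ and $\nu(\alpha^1)=t^n_{k-1})$. $\mathcal{RM}_{C_n}=(\mathcal{A}_{C_n},D_n,\mathcal{F}_{C_n})$; $\Gamma\vDash^{\mathsf{RN}}_{\mathcal{RM}_{C_n}}\varphi$ iff every $\nu\in\mathcal{F}_{C_n}$ with $\nu[\Gamma]\subseteq D_n$ has $\nu(\varphi)\in D_n$. -}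

module Defs where

open import Data.Bool using (Bool; true; false; not; _∧_; _∨_)
import Data.Bool as Bool
open import Data.Bool.ListAction using (and)
open import Data.Bool.Properties using (∨-zeroʳ)
open import Data.Fin using (Fin; zero; suc; toℕ; fromℕ<)
open import Data.Irrelevant using ([_])
open import Data.List using (take)
open import Data.Nat using (ℕ; zero; suc; _+_; _≤_; _<_; _≡ᵇ_)
open import Data.Nat.Properties using (m≤n⇒m≤1+n)
open import Data.Product using (_×_; proj₁)
open import Data.Refinement using (Refinement-syntax; _,_; value)
open import Data.Sum using (_⊎_)
open import Data.Vec using (Vec; lookup; tabulate; toList)
open import Data.Vec.Properties using (lookup∘tabulate)
open import Level using (0ℓ) renaming (suc to lsuc)
open import Relation.Binary.PropositionalEquality using (_≡_; refl; trans; cong)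
open import Relation.Unary using (Pred; _∈_; _∉_; _⊆_)

data Connective : Set where
  and′ or′ imp′ : Connective

data Formula : Set where
  var : ℕ → Formula
  ¬ᶠ_ : Formula → Formula
  bin : Connective → Formula → Formula → Formula

infix  9 ¬ᶠ_
infixl 7 _∧ᶠ_
infixl 6 _∨ᶠ_
infixr 5 _→ᶠ_

pattern _∧ᶠ_ α β = bin and′ α β
pattern _∨ᶠ_ α β = bin or′ α β
pattern _→ᶠ_ α β = bin imp′ α β

infixl 10 _^_ _^⟨_⟩

_^_ : Formula → ℕ → Formula
α ^ zero  = α
α ^ suc k = ¬ᶠ (α ^ k ∧ᶠ ¬ᶠ (α ^ k))

-- α ^⟨ k ⟩ is α^{(k)}, which is meaningful for k ≥ 1 only; the value at
-- k = 0 is a dummy.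
_^⟨_⟩ : Formula → ℕ → Formula
α ^⟨ zero ⟩        = α
α ^⟨ suc zero ⟩    = α ^ 1
α ^⟨ suc (suc k) ⟩ = α ^⟨ suc k ⟩ ∧ᶠ α ^ suc (suc k)

data Axiom (n : ℕ) : Pred Formula 0ℓ where
  K    : ∀ α β → Axiom n (α →ᶠ (β →ᶠ α))
  S    : ∀ α β γ → Axiom n ((α →ᶠ (β →ᶠ γ)) →ᶠ ((α →ᶠ β) →ᶠ (α →ᶠ γ)))
  ∧-I  : ∀ α β → Axiom n (α →ᶠ (β →ᶠ (α ∧ᶠ β)))
  ∧-E₁ : ∀ α β → Axiom n ((α ∧ᶠ β) →ᶠ α)
  ∧-E₂ : ∀ α β → Axiom n ((α ∧ᶠ β) →ᶠ β)
  ∨-I₁ : ∀ α β → Axiom n (α →ᶠ (α ∨ᶠ β))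
  ∨-I₂ : ∀ α β → Axiom n (β →ᶠ (α ∨ᶠ β))
  ∨-E  : ∀ α β γ → Axiom n ((α →ᶠ γ) →ᶠ ((β →ᶠ γ) →ᶠ ((α ∨ᶠ β) →ᶠ γ)))
  em   : ∀ α → Axiom n (α ∨ᶠ ¬ᶠ α)
  cf   : ∀ α → Axiom n (¬ᶠ ¬ᶠ α →ᶠ α)
  bc   : ∀ α β → Axiom n (α ^⟨ n ⟩ →ᶠ (α →ᶠ (¬ᶠ α →ᶠ β)))
  prop : ∀ α β → Axiom n ((α ^⟨ n ⟩ ∧ᶠ β ^⟨ n ⟩) →ᶠ
           ((α ∧ᶠ β) ^⟨ n ⟩ ∧ᶠ (α ∨ᶠ β) ^⟨ n ⟩ ∧ᶠ (α →ᶠ β) ^⟨ n ⟩))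

infix 3 _⊢C[_]_

data _⊢C[_]_ (Γ : Pred Formula 0ℓ) (n : ℕ) : Formula → Set where
  hyp : ∀ {α} → α ∈ Γ → Γ ⊢C[ n ] α
  ax  : ∀ {α} → Axiom n α → Γ ⊢C[ n ] α
  mp  : ∀ {α β} → Γ ⊢C[ n ] α → Γ ⊢C[ n ] (α →ᶠ β) → Γ ⊢C[ n ] β

-- Multioperations are given as relations: w ∈ neg z means w ∈ ¬̃ z.
record Multialgebra : Set (lsuc 0ℓ) where
  field
    Carrier : Set
    neg     : Carrier → Pred Carrier 0ℓ
    op      : Connective → Carrier → Carrier → Pred Carrier 0ℓ

record IsValuation (A : Multialgebra) (ν : Formula → Multialgebra.Carrier A) : Set where
  open Multialgebra A
  field
    ν-neg : ∀ α → ν (¬ᶠ α) ∈ neg (ν α)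
    ν-op  : ∀ # α β → ν (bin # α β) ∈ op # (ν α) (ν β)

record RNmatrix : Set (lsuc 0ℓ) where
  field
    algebra      : Multialgebra
  open Multialgebra algebra public
  field
    Designated   : Pred Carrier 0ℓ
    Admissible   : Pred (Formula → Carrier) 0ℓ
    isValuation  : Admissible ⊆ IsValuation algebra

infix 3 _⊨RN[_]_

_⊨RN[_]_ : Pred Formula 0ℓ → RNmatrix → Formula → Set
Γ ⊨RN[ M ] φ =
  ∀ ν → ν ∈ Admissible → (∀ γ → γ ∈ Γ → ν γ ∈ Designated) → ν φ ∈ Designated
  where open RNmatrix M

-- i : Fin n stands for k = toℕ i + 1, so that "lookup z (suc i)" is the
-- coordinate z_{k+1} in the 1-based numbering.
InB : (n : ℕ) → Pred (Vec Bool (suc n)) 0ℓ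
InB n z = ∀ (i : Fin n) → and (take (suc (toℕ i)) (toList z)) ∨ lookup z (suc i) ≡ true

-- The membership proof is irrelevant, so equality in B n is equality of
-- the underlying tuples.
B : ℕ → Set
B n = [ z ∈ Vec Bool (suc n) ∣ InB n z ]

-- The (n+1)-tuple whose only 0 is at the 1-based coordinate j, and which
-- is (1,…,1) if there is no such coordinate.
onesExcept : ℕ → (n : ℕ) → Vec Bool (suc n)
onesExcept j n = tabulate (λ i → not (suc (toℕ i) ≡ᵇ j))

onesExcept-InB : ∀ j n → InB n (onesExcept j n)
onesExcept-InB zero n i =
  trans (cong (and (take (suc (toℕ i)) (toList (onesExcept 0 n))) ∨_)
          (lookup∘tabulate (λ i → not (suc (toℕ i) ≡ᵇ 0)) (suc i)))
        (∨-zeroʳ _)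
onesExcept-InB (suc zero) n i =
  lookup∘tabulate (λ i → not (suc (toℕ i) ≡ᵇ 1)) (suc i)
onesExcept-InB (suc (suc j)) (suc n) zero    = refl
onesExcept-InB (suc (suc j)) (suc n) (suc i) = onesExcept-InB (suc j) n i

Tₙ Fₙ : (n : ℕ) → B n
Tₙ n = onesExcept 2 n , [ onesExcept-InB 2 n ]
Fₙ n = onesExcept 1 n , [ onesExcept-InB 1 n ]

-- t n i is t^n_i for 0 ≤ i ≤ n-1.  For i = n-1 the coordinate i+3 = n+2
-- does not exist, so that t n (n-1) = (1,…,1).
t : (n : ℕ) → ℕ → B n
t n i = onesExcept (i + 3) n , [ onesExcept-InB (i + 3) n ]

Boo : (n : ℕ) → Pred (B n) 0ℓ
Boo n z = z ≡ Tₙ n ⊎ z ≡ Fₙ n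

I : (n : ℕ) → Pred (B n) 0ℓ
I n z = z ∉ Boo n

⟦_⟧ : Connective → Bool → Bool → Bool
⟦ and′ ⟧ a b = a ∧ b
⟦ or′  ⟧ a b = a ∨ b
⟦ imp′ ⟧ a b = not a ∨ b

module _ (n : ℕ) (2≤n : 2 ≤ n) where

  z₁ z₂ : B n → Bool
  z₁ z = lookup (value z) zero
  z₂ z = lookup (value z) (fromℕ< {1} (m≤n⇒m≤1+n 2≤n))

  Dₙ : Pred (B n) 0ℓ
  Dₙ z = z₁ z ≡ true

  -- In "op" the implication restricts u to Boo_n exactly when both
  -- arguments are in Boo_n.
  𝒜 : Multialgebra
  𝒜 = record
    { Carrier = B n
    ; neg     = λ z w → z₁ w ≡ z₂ z × z₂ w Bool.≤ z₁ z
    ; op      = λ # z w u → z₁ u ≡ ⟦ # ⟧ (z₁ z) (z₁ w)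
                          × (z ∈ Boo n × w ∈ Boo n → u ∈ Boo n)
    }

  ℱ : Pred (Formula → B n) 0ℓ
  ℱ ν = IsValuation 𝒜 ν
      × (∀ α → ν α ≡ t n 0 → ν (α ∧ᶠ ¬ᶠ α) ≡ Tₙ n)
      × (∀ α k → suc k < n → ν α ≡ t n (suc k) →
           ν (α ∧ᶠ ¬ᶠ α) ∈ I n × ν (α ^ 1) ≡ t n k)

  RM : RNmatrix
  RM = record
    { algebra     = 𝒜
    ; Designated  = Dₙ
    ; Admissible  = ℱ
    ; isValuation = proj₁
    }

{-# OPTIONS --safe #-}

-- Derivability and RNmatrix consequence are both compared with bivaluations
-- b : Formula → Bool.
-- A formula behaves classically under b when α and ¬α are not both true; this
-- is equivalent to b (α^(n)) = 1 and is inherited by α¹, α², ….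
--
-- Every tuple of B_n has at most one 0, so it is T_n, F_n or some t_k, and it
-- is in Boo_n iff its first two coordinates are not both 1.  If ν(α) = t_k,
-- the restrictions on ν shift the 0 one place to the left at each step
-- α ↦ α¹, until ν(α^{k+1}) is undesignated; hence α^(n) is designated iff
-- ν(α) ∈ Boo_n, and the first coordinate of ν is a bivaluation.  Conversely
-- a bivaluation b yields the snapshot valuation
-- ν(α) = (b(α), b(¬α), b(α¹), …, b(α^{n-1})).
--
-- If Γ ⊬ φ, then a maximal extension of Γ not proving φ is the set of true
-- formulas of a bivaluation.
module Submission where

open import Axiom.ExcludedMiddle using (ExcludedMiddle)
open import Data.Nat using (ℕ; _≤_)
open import Function.Bundles using (_⇔_)
open import Level using (0ℓ)
open import Relation.Unary using (Pred)
open import Defs using (Formula; _⊢C[_]_; _⊨RN[_]_; RM)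

open import Data.Bool using (Bool; true; false; not; _∧_; _∨_; b≤b)
import Data.Bool as Bool
open import Data.Bool.ListAction using (and)
open import Data.Bool.Properties using (∧-zeroʳ; ∨-zeroʳ; ∧-conicalˡ; ∧-conicalʳ; ¬-not; ≤-maximum)
open import Data.Fin using (Fin; zero; suc; toℕ; fromℕ<)
open import Data.Fin.Properties using (any?; toℕ-fromℕ<; toℕ-injective; toℕ<n)
open import Data.Irrelevant using ([_])
open import Data.List using (List; []; _∷_; _++_; map; take; foldl; cartesianProductWith)
open import Data.List.Membership.Propositional using () renaming (_∈_ to _∈ˡ_)
open import Data.List.Membership.Propositional.Properties using (∈-++⁺ˡ; ∈-++⁺ʳ; ∈-map⁺; ∈-cartesianProductWith⁺)
open import Data.List.Relation.Unary.Any using (here; there)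
open import Data.Nat using (zero; suc; _+_; _⊔_; _<_; _≡ᵇ_; z≤n; s≤s; _≤′_; ≤′-refl; ≤′-step)
open import Data.Nat.Properties using (_≟_; <-cmp; <⇒≢; ≤-refl; ≤-reflexive; ≤-trans; ≤-pred; ≤⇒≤′; m≤n⇒m≤1+n; m≤m⊔n; m≤n⊔m; m≤n⇒m<n∨m≡n; +-comm; suc-injective)
open import Data.Product using (∃; _×_; _,_; proj₁; proj₂)
open import Data.Refinement using (value; value-injective) renaming (_,_ to _,ᴮ_)
open import Data.Sum using (_⊎_; inj₁; inj₂)
open import Data.Vec using (Vec; _∷_; lookup; tabulate; toList)
open import Data.Vec.Properties using (lookup∘tabulate; tabulate∘lookup; tabulate-cong)
open import Function using (_∘_; mk⇔)
open import Relation.Binary.Definitions using (tri<; tri≈; tri>)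
open import Relation.Binary.PropositionalEquality using (_≡_; _≢_; refl; sym; trans; cong; cong₂; subst)
open import Relation.Nullary using (¬_; yes; no; does; contradiction; recompute)
open import Relation.Nullary.Decidable using (dec-true; dec-false)
open import Relation.Unary using (_∈_; _⊆_; _∪_; ｛_｝)
open import Defs hiding (Formula; _⊢C[_]_; _⊨RN[_]_; RM)

-- Booleans and iterates of a formula

true-and-false : ∀ {a} {A : Set a} {x : Bool} → x ≡ true → x ≡ false → A
true-and-false refl ()

∧-false : ∀ {x y} → (x ≡ true → y ≡ false) → x ∧ y ≡ false
∧-false {true}  f = f refl
∧-false {false} _ = refl

-- `_^_` adds its layers on the outside; this form lets an induction on the exponent pass from `α`
-- to `α ^ 1`.
^-suc : ∀ α k → (α ^ 1) ^ k ≡ α ^ suc k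
^-suc α zero    = refl
^-suc α (suc k) = cong (λ γ → ¬ᶠ (γ ∧ᶠ ¬ᶠ γ)) (^-suc α k)

-- Bivaluations

-- The clauses that govern the iterates `α ^ k`. They stand apart because their consequences serve
-- to prove the remaining clauses, both for restricted valuations and for maximal theories.
record IsWeakBivaluation (b : Formula → Bool) : Set where
  field
    b-∧  : ∀ α β → b (α ∧ᶠ β) ≡ b α ∧ b β
    b-em : ∀ α → b α ≡ false → b (¬ᶠ α) ≡ true
    b-cf : ∀ α → b α ≡ false → b (¬ᶠ ¬ᶠ α) ≡ false

  Consistent : Formula → Set
  Consistent α = b α ∧ b (¬ᶠ α) ≡ false

  consistent⇒^1 : ∀ α → Consistent α → b (α ^ 1) ≡ true
  consistent⇒^1 α c = b-em _ (trans (b-∧ α (¬ᶠ α)) c)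

  -- `α ^ 1` negates `α ∧ᶠ ¬ᶠ α`, which is false here, so `b-cf` makes the double negation
  -- `¬ᶠ (α ^ 1)` false.
  consistent-^1 : ∀ α → Consistent α → Consistent (α ^ 1)
  consistent-^1 α c =
    trans (cong (b (α ^ 1) ∧_) (b-cf _ (trans (b-∧ α (¬ᶠ α)) c))) (∧-zeroʳ _)

  consistent-^-mono : ∀ α {j k} → j ≤′ k → Consistent (α ^ j) → Consistent (α ^ k)
  consistent-^-mono α ≤′-refl     c = c
  consistent-^-mono α (≤′-step p) c = consistent-^1 _ (consistent-^-mono α p c)

  consistent-^⇒^suc : ∀ α {j k} → j ≤ k → Consistent (α ^ j) → b (α ^ suc k) ≡ true
  consistent-^⇒^suc α j≤k c = consistent⇒^1 _ (consistent-^-mono α (≤⇒≤′ j≤k) c)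

  ^⟨⟩-true⁺ : ∀ α m → (∀ k → k ≤ m → b (α ^ suc k) ≡ true) → b (α ^⟨ suc m ⟩) ≡ true
  ^⟨⟩-true⁺ α zero    h = h 0 z≤n
  ^⟨⟩-true⁺ α (suc m) h = trans (b-∧ _ _)
    (cong₂ _∧_ (^⟨⟩-true⁺ α m (λ k → h k ∘ m≤n⇒m≤1+n)) (h (suc m) ≤-refl))

  ^⟨⟩-true⁻ : ∀ α m → b (α ^⟨ suc m ⟩) ≡ true → ∀ k → k ≤ m → b (α ^ suc k) ≡ true
  ^⟨⟩-true⁻ α zero    h zero z≤n = h
  ^⟨⟩-true⁻ α (suc m) h k k≤1+m with m≤n⇒m<n∨m≡n k≤1+m
  ... | inj₁ k<1+m = ^⟨⟩-true⁻ α m (∧-conicalˡ _ _ (trans (sym (b-∧ _ _)) h)) k (≤-pred k<1+m)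
  ... | inj₂ refl  = ∧-conicalʳ _ _ (trans (sym (b-∧ _ _)) h)

  consistent⇒^⟨⟩ : ∀ α m → Consistent α → b (α ^⟨ suc m ⟩) ≡ true
  consistent⇒^⟨⟩ α m c = ^⟨⟩-true⁺ α m (λ k _ → consistent-^⇒^suc α {0} {k} z≤n c)

record IsBivaluation (n : ℕ) (b : Formula → Bool) : Set where
  field
    isWeakBivaluation : IsWeakBivaluation b
  open IsWeakBivaluation isWeakBivaluation public
  field
    b-∨    : ∀ α β → b (α ∨ᶠ β) ≡ b α ∨ b β
    b-→    : ∀ α β → b (α →ᶠ β) ≡ not (b α) ∨ b β
    b-bc   : ∀ α → b (α ^⟨ n ⟩) ≡ true → Consistent α
    b-prop : ∀ # α β → b (α ^⟨ n ⟩) ≡ true → b (β ^⟨ n ⟩) ≡ true →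
             b (bin # α β ^⟨ n ⟩) ≡ true

  b-op : ∀ # α β → b (bin # α β) ≡ ⟦ # ⟧ (b α) (b β)
  b-op and′ = b-∧
  b-op or′  = b-∨
  b-op imp′ = b-→

-- Soundness of the calculus for bivaluations

module _ {n b} (isBiv : IsBivaluation n b) where
  open IsBivaluation isBiv

  private
    True : Formula → Set
    True α = b α ≡ true

    ∧⁺ : ∀ {α β} → True α → True β → True (α ∧ᶠ β)
    ∧⁺ p q = trans (b-∧ _ _) (cong₂ _∧_ p q)

    ∧⁻ˡ : ∀ {α β} → True (α ∧ᶠ β) → True α
    ∧⁻ˡ p = ∧-conicalˡ _ _ (trans (sym (b-∧ _ _)) p)

    ∧⁻ʳ : ∀ {α β} → True (α ∧ᶠ β) → True β
    ∧⁻ʳ p = ∧-conicalʳ _ _ (trans (sym (b-∧ _ _)) p)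

    ∨⁺ˡ : ∀ {α β} → True α → True (α ∨ᶠ β)
    ∨⁺ˡ {β = β} p = trans (b-∨ _ _) (cong (_∨ b β) p)

    ∨⁺ʳ : ∀ {α β} → True β → True (α ∨ᶠ β)
    ∨⁺ʳ {α} p = trans (b-∨ _ _) (trans (cong (b α ∨_) p) (∨-zeroʳ _))

    ∨⁻ : ∀ {α β} {A : Set} → (True α → A) → (True β → A) → True (α ∨ᶠ β) → A
    ∨⁻ {α} {β} f g p with b α | trans (sym (b-∨ α β)) p
    ... | true  | _ = f refl
    ... | false | q = g q

    →⁺ : ∀ {α β} → (True α → True β) → True (α →ᶠ β)
    →⁺ {α} {β} f with b α in eq
    ... | true  = trans (b-→ α β) (cong₂ (λ x y → not x ∨ y) eq (f refl))
    ... | false = trans (b-→ α β) (cong (λ x → not x ∨ b β) eq)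

    →⁻ : ∀ {α β} → True (α →ᶠ β) → True α → True β
    →⁻ {α} {β} p q = trans (cong (λ x → not x ∨ b β) (sym q)) (trans (sym (b-→ α β)) p)

  -- The rules above turn each positive axiom into the lambda term that inhabits it; `em`, `cf`,
  -- `bc` and `prop` rest on the clauses for negation and consistency.
  axiom-true : ∀ {α} → Axiom n α → b α ≡ true
  axiom-true (K α β)      = →⁺ λ a → →⁺ λ _ → a
  axiom-true (S α β γ)    = →⁺ λ f → →⁺ λ g → →⁺ λ a → →⁻ (→⁻ f a) (→⁻ g a)
  axiom-true (∧-I α β)    = →⁺ λ p → →⁺ λ q → ∧⁺ p q
  axiom-true (∧-E₁ α β)   = →⁺ ∧⁻ˡ
  axiom-true (∧-E₂ α β)   = →⁺ ∧⁻ʳ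
  axiom-true (∨-I₁ α β)   = →⁺ ∨⁺ˡ
  axiom-true (∨-I₂ α β)   = →⁺ ∨⁺ʳ
  axiom-true (∨-E α β γ)  = →⁺ λ f → →⁺ λ g → →⁺ (∨⁻ (→⁻ f) (→⁻ g))
  axiom-true (em α) with b α Bool.≟ true
  ... | yes p = ∨⁺ˡ p
  ... | no ¬p = ∨⁺ʳ (b-em α (¬-not ¬p))
  axiom-true (cf α)       = →⁺ λ p → ¬-not (true-and-false p ∘ b-cf α)
  axiom-true (bc α β)     = →⁺ λ c → →⁺ λ p → →⁺ λ q →
    true-and-false (cong₂ _∧_ p q) (b-bc α c)
  axiom-true (prop α β)   = →⁺ λ p →
    let preserved = λ # → b-prop # α β (∧⁻ˡ p) (∧⁻ʳ p)
    in  ∧⁺ (∧⁺ (preserved and′) (preserved or′)) (preserved imp′)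

  derivable-true : ∀ {Γ φ} → (∀ γ → γ ∈ Γ → b γ ≡ true) → Γ ⊢C[ n ] φ → b φ ≡ true
  derivable-true h (hyp γ∈Γ) = h _ γ∈Γ
  derivable-true h (ax a)    = axiom-true a
  derivable-true h (mp d e)  = →⁻ (derivable-true h e) (derivable-true h d)

-- The tuples of B_n

and-take-false⁺ : ∀ {l} (z : Vec Bool l) k (j : Fin l) → toℕ j < k → lookup z j ≡ false →
                  and (take k (toList z)) ≡ false
and-take-false⁺ (x ∷ z) (suc k) zero    _         refl = refl
and-take-false⁺ (x ∷ z) (suc k) (suc j) (s≤s j<k) eq   =
  trans (cong (x ∧_) (and-take-false⁺ z k j j<k eq)) (∧-zeroʳ x)

and-take-false⁻ : ∀ {l} (z : Vec Bool l) k → and (take k (toList z)) ≡ false →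
                  ∃ λ (j : Fin l) → toℕ j < k × lookup z j ≡ false
and-take-false⁻ (false ∷ z) (suc k) eq = zero , s≤s z≤n , refl
and-take-false⁻ (true ∷ z)  (suc k) eq with and-take-false⁻ z k eq
... | j , j<k , zj = suc j , s≤s j<k , zj

-- A prefix conjunction is 0 only if some coordinate in it is 0, so membership reduces to having
-- only 1s after a 0.
InB⁺ : ∀ {n} {z : Vec Bool (suc n)} →
       (∀ {i j} → toℕ j < toℕ i → lookup z j ≡ false → lookup z i ≡ true) → InB n z
InB⁺ {n} {z} h i with and (take (suc (toℕ i)) (toList z)) in eq
... | true  = refl
... | false with and-take-false⁻ z (suc (toℕ i)) eq
... | j , j<i , zj = h {suc i} {j} j<i zj

InB⁻ : ∀ {n} (z : B n) {i j} → toℕ j < toℕ i →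
       lookup (value z) j ≡ false → lookup (value z) i ≡ true
InB⁻ (z ,ᴮ [ p ]) {suc i} {j} j<i zj =
  trans (cong (_∨ lookup z (suc i)) (sym (and-take-false⁺ z _ j j<i zj)))
        -- The membership proof is irrelevant, but equality of Booleans is decidable, so a usable
        -- proof can be recovered.
        (recompute (_ Bool.≟ true) (p i))

vec-ext : ∀ {A : Set} {l} {xs : Vec A l} {f : Fin l → A} →
          (∀ i → lookup xs i ≡ f i) → xs ≡ tabulate f
vec-ext h = trans (sym (tabulate∘lookup _)) (tabulate-cong h)

≡ᵇ-false : ∀ {i j} → i ≢ j → (i ≡ᵇ j) ≡ false
≡ᵇ-false i≢j = dec-false (_ ≟ _) i≢j

≡ᵇ-true : ∀ {i j} → i ≡ j → (i ≡ᵇ j) ≡ true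
≡ᵇ-true i≡j = dec-true (_ ≟ _) i≡j

lookup-onesExcept : ∀ {n} (i : Fin (suc n)) j → lookup (onesExcept j n) i ≡ not (suc (toℕ i) ≡ᵇ j)
lookup-onesExcept i j = lookup∘tabulate (λ i → not (suc (toℕ i) ≡ᵇ j)) i

-- Membership forces 1s after the 0 at `i`; an earlier 0 would likewise force a 1 at `i`.
zero-determines : ∀ {n} (z : B n) i → lookup (value z) i ≡ false →
                  value z ≡ onesExcept (suc (toℕ i)) n
zero-determines z i zi = vec-ext λ j → at j (<-cmp (toℕ j) (toℕ i))
  where
  at : ∀ j → _ → lookup (value z) j ≡ not (toℕ j ≡ᵇ toℕ i)
  at j (tri< j<i j≢i _) =
    trans (¬-not (λ zj → true-and-false (InB⁻ z j<i zj) zi)) (cong not (sym (≡ᵇ-false j≢i)))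
  at j (tri≈ _ j≡i _) = trans (trans (cong (lookup (value z)) (toℕ-injective j≡i)) zi)
    (cong not (sym (≡ᵇ-true j≡i)))
  at j (tri> _ j≢i i<j) = trans (InB⁻ z i<j zi) (cong not (sym (≡ᵇ-false j≢i)))

module Tuples (m : ℕ) where
  private
    n : ℕ
    n = suc (suc m)

  -- For `n` of the form `suc (suc m)`, `z₁` and `z₂` reduce to these, whatever the proof of
  -- `2 ≤ n`.
  c₁ c₂ : B n → Bool
  c₁ z = lookup (value z) zero
  c₂ z = lookup (value z) (suc zero)

  c₁-false⇒c₂-true : ∀ z → c₁ z ≡ false → c₂ z ≡ true
  c₁-false⇒c₂-true z = InB⁻ z {suc zero} {zero} (s≤s z≤n)

  c₁-false⇒Fₙ : ∀ z → c₁ z ≡ false → z ≡ Fₙ n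
  c₁-false⇒Fₙ z p = value-injective (zero-determines z zero p)

  c₂-false⇒Tₙ : ∀ z → c₂ z ≡ false → z ≡ Tₙ n
  c₂-false⇒Tₙ z p = value-injective (zero-determines z (suc zero) p)

  Boo⁺ : ∀ z → c₁ z ∧ c₂ z ≡ false → z ∈ Boo n
  Boo⁺ z p with c₁ z in eq
  ... | true  = inj₁ (c₂-false⇒Tₙ z p)
  ... | false = inj₂ (c₁-false⇒Fₙ z eq)

  Boo⁻ : ∀ {z} → z ∈ Boo n → c₁ z ∧ c₂ z ≡ false
  Boo⁻ (inj₁ refl) = refl
  Boo⁻ (inj₂ refl) = refl

  zero⇒t : ∀ z k (i : Fin (suc n)) → toℕ i ≡ suc (suc k) → lookup (value z) i ≡ false → z ≡ t n k
  zero⇒t z k i eq zi = value-injective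
    (trans (zero-determines z i zi)
           (cong (λ j → onesExcept j n) (trans (cong suc eq) (+-comm 3 k))))

  not-Boo⇒t : ∀ z → c₁ z ∧ c₂ z ≡ true → ∃ λ k → k < n × z ≡ t n k
  not-Boo⇒t z p with any? (λ i → lookup (value z) i Bool.≟ false)
  ... | yes (zero        , zᵢ) = true-and-false (∧-conicalˡ _ _ p) zᵢ
  ... | yes (suc zero    , zᵢ) = true-and-false (∧-conicalʳ (c₁ z) _ p) zᵢ
  ... | yes (suc (suc i) , zᵢ) =
    toℕ i , m≤n⇒m≤1+n (toℕ<n i) , zero⇒t z (toℕ i) (suc (suc i)) refl zᵢ
  -- Without a 0 the tuple is t_{n-1}: the position of its 0 lies just past the last coordinate.
  ... | no ¬zero = suc m , ≤-refl , value-injective (vec-ext λ i →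
    trans (¬-not (λ zᵢ → ¬zero (i , zᵢ)))
          (cong not (sym (≡ᵇ-false (<⇒≢ (s≤s (≤-trans (toℕ<n i) (≤-reflexive (+-comm 3 m)))))))))

  lookup-t : ∀ {z k} (i : Fin (suc n)) → z ≡ t n k → toℕ i ≢ suc (suc k) → lookup (value z) i ≡ true
  lookup-t {k = k} i refl i≢ = trans (lookup-onesExcept i (k + 3))
    (cong not (≡ᵇ-false λ eq → i≢ (suc-injective (trans eq (+-comm k 3)))))

  lookup-t-zero : ∀ {z k} (i : Fin (suc n)) → z ≡ t n k → toℕ i ≡ suc (suc k) → lookup (value z) i ≡ false
  lookup-t-zero {k = k} i refl i≡ = trans (lookup-onesExcept i (k + 3))
    (cong not (≡ᵇ-true (trans (cong suc i≡) (+-comm 3 k))))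

-- From restricted valuations to bivaluations and back

module _ (m : ℕ) (2≤n : 2 ≤ suc (suc m)) where
  open Tuples m
  private
    n : ℕ
    n = suc (suc m)

  module _ {ν : Formula → B n} (ν∈ℱ : ℱ n 2≤n ν) where
    open IsValuation (proj₁ ν∈ℱ)

    private
      b : Formula → Bool
      b α = c₁ (ν α)

      b-¬ : ∀ α → b (¬ᶠ α) ≡ c₂ (ν α)
      b-¬ α = proj₁ (ν-neg α)

      ≤false : ∀ {x y} → x Bool.≤ y → y ≡ false → x ≡ false
      ≤false b≤b refl = refl

      isWeak : IsWeakBivaluation b
      isWeak = record
        { b-∧  = λ α β → proj₁ (ν-op and′ α β)
        ; b-em = λ α p → trans (b-¬ α) (c₁-false⇒c₂-true (ν α) p)
        ; b-cf = λ α p → trans (b-¬ (¬ᶠ α)) (≤false (proj₂ (ν-neg α)) p)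
        }

      open IsWeakBivaluation isWeak

      -- The restriction at t_{k+1} gives `α ^ 1` the value t_k, which feeds the induction. At t_0
      -- it gives `α ∧ᶠ ¬ᶠ α` the value T_n, whose second coordinate 0 is the value of the negation
      -- `α ^ 1`.
      t⇒^-false : ∀ α k → k < n → ν α ≡ t n k → b (α ^ suc k) ≡ false
      t⇒^-false α zero    _    eq =
        trans (b-¬ (α ∧ᶠ ¬ᶠ α)) (cong c₂ (proj₁ (proj₂ ν∈ℱ) α eq))
      t⇒^-false α (suc k) k<n  eq = trans (cong b (sym (^-suc α (suc k))))
        (t⇒^-false (α ^ 1) k (≤-trans (m≤n⇒m≤1+n ≤-refl) k<n)
          (proj₂ (proj₂ (proj₂ ν∈ℱ) α k k<n eq)))

      ^⟨⟩⇒c₁∧c₂ : ∀ α → b (α ^⟨ n ⟩) ≡ true → c₁ (ν α) ∧ c₂ (ν α) ≡ false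
      ^⟨⟩⇒c₁∧c₂ α h = ¬-not λ p →
        let k , k<n , eq = not-Boo⇒t (ν α) p
        in  true-and-false (^⟨⟩-true⁻ α (suc m) h k (≤-pred k<n)) (t⇒^-false α k k<n eq)

      c₁∧c₂⇒consistent : ∀ α → c₁ (ν α) ∧ c₂ (ν α) ≡ false → Consistent α
      c₁∧c₂⇒consistent α = trans (cong (b α ∧_) (b-¬ α))

    ℱ⇒bivaluation : IsBivaluation n (z₁ n 2≤n ∘ ν)
    ℱ⇒bivaluation = record
      { isWeakBivaluation = isWeak
      ; b-∨    = λ α β → proj₁ (ν-op or′ α β)
      ; b-→    = λ α β → proj₁ (ν-op imp′ α β)
      ; b-bc   = λ α h → c₁∧c₂⇒consistent α (^⟨⟩⇒c₁∧c₂ α h)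
      -- Both arguments take values in Boo_n, the multioperation stays there, and such a value makes
      -- the compound consistent.
      ; b-prop = λ # α β p q → consistent⇒^⟨⟩ (bin # α β) (suc m)
          (c₁∧c₂⇒consistent (bin # α β)
            (Boo⁻ (proj₂ (ν-op # α β)
              (Boo⁺ (ν α) (^⟨⟩⇒c₁∧c₂ α p) , Boo⁺ (ν β) (^⟨⟩⇒c₁∧c₂ β q)))))
      }

  module _ {b : Formula → Bool} (isBiv : IsBivaluation n b) where
    open IsBivaluation isBiv

    private
      coordinate : Formula → ℕ → Bool
      coordinate α zero          = b α
      coordinate α (suc zero)    = b (¬ᶠ α)
      coordinate α (suc (suc k)) = b (α ^ suc k)

      -- A 0 among the first two coordinates makes `α` consistent, a later 0 makes that iterate
      -- consistent; consistency makes all further iterates true.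
      after-zero : ∀ α {i j} → j < i → coordinate α j ≡ false → coordinate α i ≡ true
      after-zero α {suc zero}    {zero}        _   p = b-em α p
      after-zero α {suc zero}    {suc j}       (s≤s ())
      after-zero α {suc (suc i)} {zero}        _   p =
        consistent-^⇒^suc α {0} {i} z≤n (cong (_∧ b (¬ᶠ α)) p)
      after-zero α {suc (suc i)} {suc zero}    _   p =
        consistent-^⇒^suc α {0} {i} z≤n (trans (cong (b α ∧_) p) (∧-zeroʳ _))
      after-zero α {suc (suc i)} {suc (suc j)} (s≤s (s≤s j<i)) p =
        consistent-^⇒^suc α j<i (cong (_∧ b (¬ᶠ (α ^ suc j))) p)

      tuple : Formula → Vec Bool (suc n)
      tuple α = tabulate (coordinate α ∘ toℕ)

      lookup-tuple : ∀ α i → lookup (tuple α) i ≡ coordinate α (toℕ i)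
      lookup-tuple α = lookup∘tabulate (coordinate α ∘ toℕ)

      tuple-InB : ∀ α → InB n (tuple α)
      tuple-InB α = InB⁺ {z = tuple α} λ {i} {j} j<i p →
        trans (lookup-tuple α i) (after-zero α j<i (trans (sym (lookup-tuple α j)) p))

    snapshot : Formula → B n
    snapshot α = tuple α ,ᴮ [ tuple-InB α ]

    private
      lookup-tuple-fromℕ< : ∀ α {j} (j<1+n : j < suc n) →
                            lookup (tuple α) (fromℕ< j<1+n) ≡ coordinate α j
      lookup-tuple-fromℕ< α j<1+n =
        trans (lookup-tuple α (fromℕ< j<1+n)) (cong (coordinate α) (toℕ-fromℕ< j<1+n))

      coordinate-t : ∀ α k {j} → snapshot α ≡ t n k → j < suc n → j ≢ suc (suc k) →
                     coordinate α j ≡ true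
      coordinate-t α k eq j<1+n j≢ = trans (sym (lookup-tuple-fromℕ< α j<1+n))
        (lookup-t {k = k} (fromℕ< j<1+n) eq (j≢ ∘ trans (sym (toℕ-fromℕ< j<1+n))))

      coordinate-t-zero : ∀ α k → snapshot α ≡ t n k → suc (suc k) < suc n →
                          coordinate α (suc (suc k)) ≡ false
      coordinate-t-zero α k eq k<n = trans (sym (lookup-tuple-fromℕ< α k<n))
        (lookup-t-zero {k = k} (fromℕ< k<n) eq (toℕ-fromℕ< k<n))

      snapshot-t⇒^-false : ∀ α k → suc k < n → snapshot α ≡ t n (suc k) →
                           b (α ^ suc (suc k)) ≡ false
      snapshot-t⇒^-false α k k<n eq with m≤n⇒m<n∨m≡n k<n
      ... | inj₁ 2+k<n = coordinate-t-zero α (suc k) eq (s≤s 2+k<n)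
      -- Here `n` is `suc (suc k)`, so `α ^ n` is not a coordinate and the tuple is all 1s. Were
      -- `α ^ n` true too, so would be `α ^⟨ n ⟩`, and `b-bc` would contradict the truth of both `α`
      -- and `¬ᶠ α`.
      ... | inj₂ refl  = ¬-not λ h →
        true-and-false
          (cong₂ _∧_ (coordinate-t α (suc k) {j = 0} eq (s≤s z≤n) (λ ()))
                     (coordinate-t α (suc k) {j = 1} eq (s≤s (s≤s z≤n)) (λ ())))
          (b-bc α (^⟨⟩-true⁺ α (suc k) (^-true h)))
        where
        ^-true : b (α ^ suc (suc k)) ≡ true → ∀ j → j ≤ suc k → b (α ^ suc j) ≡ true
        ^-true h j j≤1+k with m≤n⇒m<n∨m≡n j≤1+k
        ... | inj₁ j<1+k = coordinate-t α (suc k) {j = suc (suc j)} eq (s≤s (s≤s j<1+k))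
                             (<⇒≢ (s≤s (s≤s j<1+k)))
        ... | inj₂ refl  = h

    snapshot∈ℱ : ℱ n 2≤n snapshot
    snapshot∈ℱ = record { ν-neg = neg ; ν-op = op } , at-t₀ , at-t
      where
      neg : ∀ α → b (¬ᶠ α) ≡ b (¬ᶠ α) × b (¬ᶠ ¬ᶠ α) Bool.≤ b α
      neg α with b α in eq
      ... | true  = refl , ≤-maximum _
      ... | false = refl , subst (Bool._≤ false) (sym (b-cf α eq)) b≤b

      Boo⇒^⟨⟩ : ∀ α → snapshot α ∈ Boo n → b (α ^⟨ n ⟩) ≡ true
      Boo⇒^⟨⟩ α p = consistent⇒^⟨⟩ α (suc m) (Boo⁻ p)

      op : ∀ # α β → b (bin # α β) ≡ ⟦ # ⟧ (b α) (b β) ×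
           (snapshot α ∈ Boo n × snapshot β ∈ Boo n → snapshot (bin # α β) ∈ Boo n)
      op # α β = b-op # α β , λ (p , q) →
        Boo⁺ _ (b-bc _ (b-prop # α β (Boo⇒^⟨⟩ α p) (Boo⇒^⟨⟩ β q)))

      at-t₀ : ∀ α → snapshot α ≡ t n 0 → snapshot (α ∧ᶠ ¬ᶠ α) ≡ Tₙ n
      -- The 0 of t_0 is `b (α ^ 1)`, which is also the second coordinate of the snapshot of
      -- `α ∧ᶠ ¬ᶠ α`.
      at-t₀ α eq = c₂-false⇒Tₙ _ (lookup-t-zero (suc (suc zero)) eq refl)

      at-t : ∀ α k → suc k < n → snapshot α ≡ t n (suc k) →
             snapshot (α ∧ᶠ ¬ᶠ α) ∈ I n × snapshot (α ^ 1) ≡ t n k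
      at-t α k k<n eq =
          -- The first two coordinates at `α ∧ᶠ ¬ᶠ α` are its own value and `b (α ^ 1)`. Both are 1,
          -- since the 0 of t_{k+1} comes later.
          (λ boo → true-and-false
             (cong₂ _∧_
               (trans (b-∧ α (¬ᶠ α))
                 (cong₂ _∧_ (coordinate-t α (suc k) {j = 0} eq (s≤s z≤n) (λ ()))
                            (coordinate-t α (suc k) {j = 1} eq (s≤s (s≤s z≤n)) (λ ()))))
               (coordinate-t α (suc k) {j = 2} eq (s≤s (s≤s (s≤s z≤n))) (λ ())))
             (Boo⁻ boo))
        -- Coordinate `suc (suc k)` at `α ^ 1` is the value of `α ^ suc (suc k)`.
        , zero⇒t (snapshot (α ^ 1)) k (fromℕ< (s≤s k<n)) (toℕ-fromℕ< (s≤s k<n))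
            (trans (lookup-tuple-fromℕ< (α ^ 1) (s≤s k<n))
              (trans (cong b (^-suc α (suc k))) (snapshot-t⇒^-false α k k<n eq)))

-- Maximal theories

weaken : ∀ {n Γ Δ φ} → Γ ⊆ Δ → Γ ⊢C[ n ] φ → Δ ⊢C[ n ] φ
weaken Γ⊆Δ (hyp γ∈Γ) = hyp (Γ⊆Δ γ∈Γ)
weaken Γ⊆Δ (ax a)    = ax a
weaken Γ⊆Δ (mp d e)  = mp (weaken Γ⊆Δ d) (weaken Γ⊆Δ e)

deduction : ∀ {n Γ α φ} → Γ ∪ ｛ α ｝ ⊢C[ n ] φ → Γ ⊢C[ n ] (α →ᶠ φ)
deduction (hyp (inj₁ γ∈Γ)) = mp (hyp γ∈Γ) (ax (K _ _))
deduction {α = α} (hyp (inj₂ refl)) =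
  mp (ax (K α α)) (mp (ax (K α (α →ᶠ α))) (ax (S α (α →ᶠ α) α)))
deduction (ax a)   = mp (ax a) (ax (K _ _))
deduction (mp d e) = mp (deduction d) (mp (deduction e) (ax (S _ _ _)))

-- Enumeration of the formulas

-- Finite batches take the place of a bijection with ℕ: batch `k` holds `var k` and all compounds of
-- formulas listed before. Repetitions are harmless.
newFormulas : ℕ → List Formula
allFormulas : ℕ → List Formula

newFormulas k =
  var k ∷ map ¬ᶠ_ (allFormulas k)
       ++ cartesianProductWith (bin and′) (allFormulas k) (allFormulas k)
       ++ cartesianProductWith (bin or′)  (allFormulas k) (allFormulas k)
       ++ cartesianProductWith (bin imp′) (allFormulas k) (allFormulas k)

allFormulas zero    = []
allFormulas (suc k) = allFormulas k ++ newFormulas k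

allFormulas-mono : ∀ {α j k} → j ≤′ k → α ∈ˡ allFormulas j → α ∈ˡ allFormulas k
allFormulas-mono ≤′-refl     p = p
allFormulas-mono (≤′-step q) p = ∈-++⁺ˡ (allFormulas-mono q p)

bin∈newFormulas : ∀ # {α β k} → α ∈ˡ allFormulas k → β ∈ˡ allFormulas k →
                  bin # α β ∈ˡ newFormulas k
bin∈newFormulas and′ {k = k} p q = there (∈-++⁺ʳ (map ¬ᶠ_ (allFormulas k))
  (∈-++⁺ˡ (∈-cartesianProductWith⁺ (bin and′) p q)))
bin∈newFormulas or′ {k = k} p q = there (∈-++⁺ʳ (map ¬ᶠ_ (allFormulas k))
  (∈-++⁺ʳ (cartesianProductWith (bin and′) (allFormulas k) (allFormulas k))
    (∈-++⁺ˡ (∈-cartesianProductWith⁺ (bin or′) p q))))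
bin∈newFormulas imp′ {k = k} p q = there (∈-++⁺ʳ (map ¬ᶠ_ (allFormulas k))
  (∈-++⁺ʳ (cartesianProductWith (bin and′) (allFormulas k) (allFormulas k))
    (∈-++⁺ʳ (cartesianProductWith (bin or′) (allFormulas k) (allFormulas k))
      (∈-cartesianProductWith⁺ (bin imp′) p q))))

-- The index of a batch that contains the formula.
rank : Formula → ℕ
rank (var x)     = x
rank (¬ᶠ α)      = suc (rank α)
rank (bin # α β) = suc (rank α ⊔ rank β)

∈-newFormulas-rank : ∀ α → α ∈ˡ newFormulas (rank α)
∈-newFormulas-rank (var x)     = here refl
∈-newFormulas-rank (¬ᶠ α)      =
  there (∈-++⁺ˡ (∈-map⁺ ¬ᶠ_ (∈-++⁺ʳ (allFormulas (rank α)) (∈-newFormulas-rank α))))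
∈-newFormulas-rank (bin # α β) = bin∈newFormulas #
  (allFormulas-mono (≤⇒≤′ (s≤s (m≤m⊔n (rank α) (rank β))))
    (∈-++⁺ʳ (allFormulas (rank α)) (∈-newFormulas-rank α)))
  (allFormulas-mono (≤⇒≤′ (s≤s (m≤n⊔m (rank α) (rank β))))
    (∈-++⁺ʳ (allFormulas (rank β)) (∈-newFormulas-rank β)))

-- Lindenbaum extension

module Lindenbaum (lem : ExcludedMiddle 0ℓ) (n : ℕ) (φ : Formula) where

  -- The condition for adding `α` sits inside the predicate, so excluded middle enters only in
  -- proofs about it.
  add : Pred Formula 0ℓ → Formula → Pred Formula 0ℓ
  add Γ α = Γ ∪ (λ β → α ≡ β × ¬ (Γ ∪ ｛ α ｝ ⊢C[ n ] φ))

  addAll : Pred Formula 0ℓ → List Formula → Pred Formula 0ℓ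
  addAll = foldl add

  -- If `α` would yield `φ`, nothing is added; otherwise the result lies within `Γ ∪ ｛ α ｝`, which
  -- does not prove `φ`.
  add-⊬ : ∀ {Γ} α → ¬ (Γ ⊢C[ n ] φ) → ¬ (add Γ α ⊢C[ n ] φ)
  add-⊬ {Γ} α ⊬φ d with lem {Γ ∪ ｛ α ｝ ⊢C[ n ] φ}
  ... | yes p = ⊬φ (weaken (λ { (inj₁ x) → x ; (inj₂ (_ , ¬p)) → contradiction p ¬p }) d)
  ... | no ¬p = ¬p (weaken (λ { (inj₁ x) → inj₁ x ; (inj₂ (eq , _)) → inj₂ eq }) d)

  addAll-⊬ : ∀ {Γ} αs → ¬ (Γ ⊢C[ n ] φ) → ¬ (addAll Γ αs ⊢C[ n ] φ)
  addAll-⊬ []       ⊬φ = ⊬φ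
  addAll-⊬ (α ∷ αs) ⊬φ = addAll-⊬ αs (add-⊬ α ⊬φ)

  addAll-⊇ : ∀ {Γ} αs → Γ ⊆ addAll Γ αs
  addAll-⊇ []       γ∈Γ = γ∈Γ
  addAll-⊇ (α ∷ αs) γ∈Γ = addAll-⊇ αs (inj₁ γ∈Γ)

  -- Maximality relative to `φ`, phrased by derivability and hence stable under enlarging the
  -- theory.
  Decided : Pred Formula 0ℓ → Formula → Set
  Decided Γ α = Γ ⊢C[ n ] α ⊎ Γ ⊢C[ n ] (α →ᶠ φ)

  decided-mono : ∀ {Γ Δ α} → Γ ⊆ Δ → Decided Γ α → Decided Δ α
  decided-mono Γ⊆Δ (inj₁ d) = inj₁ (weaken Γ⊆Δ d)
  decided-mono Γ⊆Δ (inj₂ d) = inj₂ (weaken Γ⊆Δ d)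

  add-decided : ∀ Γ α → Decided (add Γ α) α
  add-decided Γ α with lem {Γ ∪ ｛ α ｝ ⊢C[ n ] φ}
  ... | yes p = inj₂ (weaken inj₁ (deduction p))
  ... | no ¬p = inj₁ (hyp (inj₂ (refl , ¬p)))

  addAll-decided : ∀ {Γ α αs} → α ∈ˡ αs → Decided (addAll Γ αs) α
  addAll-decided {αs = α ∷ αs} (here refl) = decided-mono (addAll-⊇ αs) (add-decided _ α)
  addAll-decided (there p)                 = addAll-decided p

  module _ (Γ : Pred Formula 0ℓ) where

    stage : ℕ → Pred Formula 0ℓ
    stage zero    = Γ
    stage (suc k) = addAll (stage k) (newFormulas k)

    limit : Pred Formula 0ℓ
    limit α = ∃ λ k → α ∈ stage k

    stage-mono : ∀ {j k} → j ≤′ k → stage j ⊆ stage k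
    stage-mono ≤′-refl         p = p
    stage-mono (≤′-step {k} q) p = addAll-⊇ (newFormulas k) (stage-mono q p)

    -- Stages increase, so the later of the stages for the two premises of modus ponens serves both.
    limit-compact : ∀ {α} → limit ⊢C[ n ] α → ∃ λ k → stage k ⊢C[ n ] α
    limit-compact (hyp (k , p)) = k , hyp p
    limit-compact (ax a)        = 0 , ax a
    limit-compact (mp d e) with limit-compact d | limit-compact e
    ... | j , d′ | k , e′ = j ⊔ k ,
      mp (weaken (stage-mono (≤⇒≤′ (m≤m⊔n j k))) d′) (weaken (stage-mono (≤⇒≤′ (m≤n⊔m j k))) e′)

    stage-⊬ : ¬ (Γ ⊢C[ n ] φ) → ∀ k → ¬ (stage k ⊢C[ n ] φ)
    stage-⊬ ⊬φ zero    = ⊬φ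
    stage-⊬ ⊬φ (suc k) = addAll-⊬ (newFormulas k) (stage-⊬ ⊬φ k)

    limit-⊬ : ¬ (Γ ⊢C[ n ] φ) → ¬ (limit ⊢C[ n ] φ)
    limit-⊬ ⊬φ d = let k , d′ = limit-compact d in stage-⊬ ⊬φ k d′

    limit-decided : ∀ α → Decided limit α
    limit-decided α =
      decided-mono (λ p → suc (rank α) , p) (addAll-decided (∈-newFormulas-rank α))

-- Truth in a maximal theory

module MaximalTheory (lem : ExcludedMiddle 0ℓ) (m : ℕ) (Δ : Pred Formula 0ℓ) (φ : Formula)
  (Δ⊬φ : ¬ (Δ ⊢C[ suc m ] φ))
  (decided : ∀ α → Δ ⊢C[ suc m ] α ⊎ Δ ⊢C[ suc m ] (α →ᶠ φ)) where

  private
    n : ℕ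
    n = suc m

    infix 3 ⊢_
    ⊢_ : Formula → Set
    ⊢ α = Δ ⊢C[ n ] α

  truth : Formula → Bool
  truth α = does (lem {⊢ α})

  truth⁺ : ∀ {α} → ⊢ α → truth α ≡ true
  truth⁺ = dec-true lem

  truth⁻ : ∀ {α} → truth α ≡ true → ⊢ α
  truth⁻ {α} eq with lem {⊢ α}
  ... | yes p = p

  truth-false⁺ : ∀ {α} → ¬ (⊢ α) → truth α ≡ false
  truth-false⁺ = dec-false lem

  truth-false⁻ : ∀ {α} → truth α ≡ false → ¬ (⊢ α)
  truth-false⁻ {α} eq with lem {⊢ α}
  ... | no ¬p = ¬p

  -- If neither disjunct were provable, both would imply `φ`, and `∨-E` would prove `φ`.
  ∨-prime : ∀ {α β} → ⊢ α ∨ᶠ β → ¬ (⊢ α) → ⊢ β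
  ∨-prime {α} {β} d ¬a with decided α | decided β
  ... | inj₁ a | _      = contradiction a ¬a
  ... | inj₂ _ | inj₁ b = b
  ... | inj₂ f | inj₂ g = contradiction (mp d (mp g (mp f (ax (∨-E α β φ))))) Δ⊬φ

  truth-isWeakBivaluation : IsWeakBivaluation truth
  truth-isWeakBivaluation = record
    { b-∧  = truth-∧
    ; b-em = λ α p → truth⁺ (∨-prime (ax (em α)) (truth-false⁻ p))
    ; b-cf = λ α p → truth-false⁺ λ d → truth-false⁻ p (mp d (ax (cf α)))
    }
    where
    truth-∧ : ∀ α β → truth (α ∧ᶠ β) ≡ truth α ∧ truth β
    truth-∧ α β with lem {⊢ α} | lem {⊢ β}
    ... | yes a | yes b = truth⁺ (mp b (mp a (ax (∧-I α β))))
    ... | yes _ | no ¬b = truth-false⁺ λ d → ¬b (mp d (ax (∧-E₂ α β)))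
    ... | no ¬a | _     = truth-false⁺ λ d → ¬a (mp d (ax (∧-E₁ α β)))

  open IsWeakBivaluation truth-isWeakBivaluation

  -- An unprovable α is consistent, so that bc and ¬α refute it: this replaces
  -- Peirce's law, which is not among the axioms.
  ⊬⇒⊢→ : ∀ {α} β → ¬ (⊢ α) → ⊢ α →ᶠ β
  ⊬⇒⊢→ {α} β ¬a = deduction (mp (weaken inj₁ (∨-prime (ax (em α)) ¬a))
    (mp (hyp (inj₂ refl)) (mp (weaken inj₁ α^⟨n⟩) (ax (bc α β)))))
    where
    α^⟨n⟩ : ⊢ α ^⟨ n ⟩
    α^⟨n⟩ = truth⁻ (consistent⇒^⟨⟩ α m (cong (_∧ truth (¬ᶠ α)) (truth-false⁺ ¬a)))

  truth-isBivaluation : IsBivaluation n truth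
  truth-isBivaluation = record
    { isWeakBivaluation = truth-isWeakBivaluation
    ; b-∨    = truth-∨
    ; b-→    = truth-→
    -- The arbitrary conclusion of `bc` is taken to be the unprovable `φ`.
    ; b-bc   = λ α c → ∧-false λ a → truth-false⁺ λ ¬a →
        Δ⊬φ (mp ¬a (mp (truth⁻ a) (mp (truth⁻ c) (ax (bc α φ)))))
    ; b-prop = λ # α β p q → truth⁺ (preserved #
        (mp (mp (truth⁻ q) (mp (truth⁻ p) (ax (∧-I _ _)))) (ax (prop α β))))
    }
    where
    truth-∨ : ∀ α β → truth (α ∨ᶠ β) ≡ truth α ∨ truth β
    truth-∨ α β with lem {⊢ α} | lem {⊢ β}
    ... | yes a | _     = truth⁺ (mp a (ax (∨-I₁ α β)))
    ... | no _  | yes b = truth⁺ (mp b (ax (∨-I₂ α β)))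
    ... | no ¬a | no ¬b = truth-false⁺ λ d → ¬b (∨-prime d ¬a)

    truth-→ : ∀ α β → truth (α →ᶠ β) ≡ not (truth α) ∨ truth β
    truth-→ α β with lem {⊢ α} | lem {⊢ β}
    ... | no ¬a | _     = truth⁺ (⊬⇒⊢→ β ¬a)
    ... | yes _ | yes b = truth⁺ (mp b (ax (K β α)))
    ... | yes a | no ¬b = truth-false⁺ λ d → ¬b (mp a d)

    preserved : ∀ # {α β} →
      ⊢ (α ∧ᶠ β) ^⟨ n ⟩ ∧ᶠ (α ∨ᶠ β) ^⟨ n ⟩ ∧ᶠ (α →ᶠ β) ^⟨ n ⟩ → ⊢ bin # α β ^⟨ n ⟩
    preserved and′ d = mp (mp d (ax (∧-E₁ _ _))) (ax (∧-E₁ _ _))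
    preserved or′  d = mp (mp d (ax (∧-E₁ _ _))) (ax (∧-E₂ _ _))
    preserved imp′ d = mp d (ax (∧-E₂ _ _))

-- Countermodels and the equivalence

countermodel : ExcludedMiddle 0ℓ → ∀ m Γ φ → ¬ (Γ ⊢C[ suc m ] φ) →
               ∃ λ b → IsBivaluation (suc m) b × (∀ γ → γ ∈ Γ → b γ ≡ true) × b φ ≡ false
countermodel lem m Γ φ ⊬φ =
  truth , truth-isBivaluation , (λ γ γ∈Γ → truth⁺ (hyp (0 , γ∈Γ))) , truth-false⁺ (limit-⊬ Γ ⊬φ)
  where
  open Lindenbaum lem (suc m) φ
  open MaximalTheory lem m (limit Γ) φ (limit-⊬ Γ ⊬φ) (limit-decided Γ)

mainTheorem13 : ExcludedMiddle 0ℓ →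
    (n : ℕ) (2≤n : 2 ≤ n) (Γ : Pred Formula 0ℓ) (φ : Formula) →
    (Γ ⊢C[ n ] φ) ⇔ (Γ ⊨RN[ RM n 2≤n ] φ)
mainTheorem13 lem (suc (suc m)) 2≤n Γ φ = mk⇔ sound complete
  where
  sound : Γ ⊢C[ suc (suc m) ] φ → Γ ⊨RN[ RM (suc (suc m)) 2≤n ] φ
  sound d ν ν∈ℱ h = derivable-true (ℱ⇒bivaluation m 2≤n ν∈ℱ) h d

  complete : Γ ⊨RN[ RM (suc (suc m)) 2≤n ] φ → Γ ⊢C[ suc (suc m) ] φ
  complete ⊨φ with lem {Γ ⊢C[ suc (suc m) ] φ}
  ... | yes d  = d
  ... | no ⊬φ =
    let b , isBiv , bΓ , bφ = countermodel lem (suc m) Γ φ ⊬φ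
    -- The first coordinate of a snapshot computes to the value under `b`, so being designated means
    -- being true under `b`.
    in  true-and-false (⊨φ (snapshot m 2≤n isBiv) (snapshot∈ℱ m 2≤n isBiv) bΓ) bφ
mainTheorem13 lem (suc zero) (s≤s ())
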